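{- Let $n\ge1$ and $r\ge0$ be integers and let $x$ be an integer. Then $$(2r+1)\prod_{k=-r}^r(x+k)(x+1-k)\sum_{k=0}^{n-1}(2k+2r+1)d_k^{(r)}(x)^2\equiv 0\pmod{2n^2(n+1)^2\cdots(n+2r)^2}.$$
   Context: For a complex number $a$ and integer $k\ge0$, $\binom{a}{k}=a(a-1)\cdots(a-k+1)/k!$. For a parameter $r$ and an integer $n\ge 0$, $d_n^{(r)}(x)=\sum_{k=0}^n\binom{x+r+k}{k}\binom{x-r}{n-k}$ (this is an integer when $x,r$ are integers). -}

module Defs where

open import Data.Nat as ℕ using (ℕ; zero; suc)
open import Data.Nat.Base using (_!)
open import Data.Nat.Properties using (_!≢0)
open import Data.Integer using (ℤ; +_; _+_; _-_; _*_; _/ℕ_)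

falling : ℤ → ℕ → ℤ
falling a zero    = + 1
falling a (suc k) = falling a k * (a - + k)

-- generalized binomial coefficient  binom a k = a(a-1)...(a-k+1)/k!
-- (the division is exact for integer a)
binom : ℤ → ℕ → ℤ
binom a k = _/ℕ_ (falling a k) (k !) {{k !≢0}}

sumBelow : ℕ → (ℕ → ℤ) → ℤ
sumBelow zero    f = + 0
sumBelow (suc n) f = sumBelow n f + f n

prodBelow : ℕ → (ℕ → ℤ) → ℤ
prodBelow zero    f = + 1
prodBelow (suc n) f = prodBelow n f * f n

d : ℤ → ℕ → ℤ → ℤ
d r n x = sumBelow (suc n) (λ k → binom (x + r + + k) k * binom (x - r) (n ℕ.∸ k))

-- Π_{k=-r}^{r} (x+k)(x+1-k), indexed by j = k + r ∈ {0,…,2r}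
prodSym : ℕ → ℤ → ℤ
prodSym r x = prodBelow (suc (2 ℕ.* r))
  (λ j → (x + (+ j - + r)) * (x + + 1 - (+ j - + r)))

modulusProd : ℕ → ℕ → ℕ
modulusProd n r = go (suc (2 ℕ.* r))
  where
  go : ℕ → ℕ
  go zero    = 1
  go (suc i) = go i ℕ.* ((n ℕ.+ i) ℕ.* (n ℕ.+ i))

{-# OPTIONS --safe #-}

-- Put X = 2x + 1, ρ = 2r + 1 and Π = (x + r)(x + r - 1) ⋯ (x - r + 1). The generating function
-- (1 - z)^(-x-r-1) (1 + z)^(x-r) of d_n gives (n + 2) d_{n+2} = X d_{n+1} + (n + ρ) d_n, and with
-- it (ρ² - X²) Σ_{k<n} (2k + ρ) d_k² telescopes to
--   ρ ((n d_n)² + ((n + 2r) d_{n-1})²) - 2 X (n d_n) ((n + 2r) d_{n-1}).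
-- Moreover Π d_n = (n + 1) ⋯ (n + 2r) e_n with e_n = Σ_i 2^i C(x + r, 2r + i) C(n, i), as both
-- sides satisfy the same recurrence. Since X² - ρ² = 4 (x - r)(x + r + 1) and the product over k
-- is (x - r)(x + r + 1) Π², the claim reduces to 8 ∣ 2 X e_n e_{n-1} - ρ (e_n² + e_{n-1}²),
-- which is seen from the first two terms of the 2-adic expansion of e_n.
module Submission where

open import Defs
open import Data.Nat as ℕ using (ℕ; zero; suc; _≥_; _∸_; s≤s)
open import Data.Nat.Base using (_!)
open import Data.Nat.Properties using (_!≢0; <⇒≱)
import Data.Nat.Properties as ℕ
import Data.Nat.Divisibility as ℕ∣
open import Data.Integer using (ℤ; +_; -[1+_]; _+_; _-_; -_; _*_; _^_; _/ℕ_; _%ℕ_)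
open import Data.Integer.Properties
  using (pos-*; *-cancelˡ-≡; *-cancelʳ-≡; *-comm; *-assoc; *-zeroʳ; +-identityˡ; +-comm; i≡j⇒i-j≡0)
open import Data.Integer.DivMod using (n%ℕd<d; a≡a%ℕn+[a/ℕn]*n)
open import Data.Integer.Divisibility using (_∣_)
import Data.Integer.Divisibility.Signed as Signed
open Signed using (divides; ∣⇒∣ᵤ) renaming (_∣_ to _∣ₛ_)
open import Data.Integer.Tactic.RingSolver using (solve-∀)
open import Function using (_∘_)
open import Relation.Nullary using (contradiction)
open import Relation.Binary.PropositionalEquality

open ≡-Reasoning

-- Falling factorials and the exact division in `binom`.

falling-sucˡ : ∀ a k → falling (+ 1 + a) (suc k) ≡ (+ 1 + a) * falling a k
falling-sucˡ a zero = lemma a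
  where
  lemma : ∀ a → + 1 * (+ 1 + a - + 0) ≡ (+ 1 + a) * + 1
  lemma = solve-∀
falling-sucˡ a (suc k) =
  trans (cong (_* (+ 1 + a - + suc k)) (falling-sucˡ a k)) (lemma a (falling a k) (+ k))
  where
  lemma : ∀ a f k → ((+ 1 + a) * f) * (+ 1 + a - (+ 1 + k)) ≡ (+ 1 + a) * (f * (a - k))
  lemma = solve-∀

falling-pascal : ∀ a k →
  falling (+ 1 + a) (suc k) ≡ falling a (suc k) + + suc k * falling a k
falling-pascal a k = trans (falling-sucˡ a k) (lemma a (falling a k) (+ k))
  where
  lemma : ∀ a f k → (+ 1 + a) * f ≡ f * (a - k) + (+ 1 + k) * f
  lemma = solve-∀

falling-0 : ∀ k → falling (+ 0) (suc k) ≡ + 0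
falling-0 zero    = refl
falling-0 (suc k) = cong (_* (+ 0 - + suc k)) (falling-0 k)

-- Outer induction on k, inner induction on a in both directions from 0. By Pascal's rule the values
-- at a and a + 1 differ by `+ suc k * falling a k`, a multiple of (k + 1)! by the outer hypothesis,
-- so divisibility passes up and down.
!∣falling : ∀ k a → + (k !) ∣ₛ falling a k
!∣falling zero    a = Signed.∣-refl
!∣falling (suc k) a = go a
  where
  step : ∀ a → + (suc k !) ∣ₛ + suc k * falling a k
  step a = subst (_∣ₛ + suc k * falling a k) (sym (pos-* (suc k) (k !)))
             (Signed.*-monoʳ-∣ (+ suc k) (!∣falling k a))

  up : ∀ a → + (suc k !) ∣ₛ falling a (suc k) → + (suc k !) ∣ₛ falling (+ 1 + a) (suc k)
  up a ih = subst (+ (suc k !) ∣ₛ_) (sym (falling-pascal a k)) (Signed.∣m∣n⇒∣m+n ih (step a))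

  down : ∀ a → + (suc k !) ∣ₛ falling (+ 1 + a) (suc k) → + (suc k !) ∣ₛ falling a (suc k)
  down a ih =
    Signed.∣m+n∣n⇒∣m (subst (+ (suc k !) ∣ₛ_) (falling-pascal a k) ih) (step a)

  go : ∀ a → + (suc k !) ∣ₛ falling a (suc k)
  go (+ zero)      = divides (+ 0) (falling-0 k)
  go (+ suc n)     = up (+ n) (go (+ n))
  go -[1+ zero ]   = down -[1+ zero ] (go (+ 0))
  go -[1+ suc n ]  = down -[1+ suc n ] (go -[1+ n ])

-- The remainder is itself a multiple of m and smaller than m, hence 0.
/ℕ-exact : ∀ a m .{{_ : ℕ.NonZero m}} → + m ∣ₛ a → (a /ℕ m) * + m ≡ a
/ℕ-exact a m m∣a = sym (begin
  a                                  ≡⟨ a≡a%ℕn+[a/ℕn]*n a m ⟩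
  + (a %ℕ m) + (a /ℕ m) * + m        ≡⟨ cong (λ z → + z + (a /ℕ m) * + m) rem≡0 ⟩
  + 0 + (a /ℕ m) * + m               ≡⟨ +-identityˡ _ ⟩
  (a /ℕ m) * + m                     ∎)
  where
  m∣rem : m ℕ∣.∣ a %ℕ m
  m∣rem = ∣⇒∣ᵤ (Signed.∣m+n∣n⇒∣m {m = + (a %ℕ m)}
    (subst (+ m ∣ₛ_) (a≡a%ℕn+[a/ℕn]*n a m) m∣a) (divides (a /ℕ m) refl))

  zero-of : ∀ k → k ℕ.< m → m ℕ∣.∣ k → k ≡ 0
  zero-of zero    _   _   = refl
  zero-of (suc k) k<m m∣k = contradiction (ℕ∣.∣⇒≤ m∣k) (<⇒≱ k<m)

  rem≡0 : a %ℕ m ≡ 0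
  rem≡0 = zero-of (a %ℕ m) (n%ℕd<d a m) m∣rem

binom-! : ∀ a k → binom a k * + (k !) ≡ falling a k
binom-! a k = /ℕ-exact (falling a k) (k !) {{k !≢0}} (!∣falling k a)
  

*suc-*! : ∀ z k → (z * + suc k) * + (k !) ≡ z * + (suc k !)
*suc-*! z k = trans (*-assoc z (+ suc k) (+ (k !))) (cong (z *_) (sym (pos-* (suc k) (k !))))

-- After multiplication by k!, `binom-!` turns both sides into falling factorials; k! is then
-- cancelled. The next recurrence is obtained in the same way.
binom-sucʳ : ∀ a k → binom a (suc k) * + suc k ≡ binom a k * (a - + k)
binom-sucʳ a k = *-cancelʳ-≡ _ _ (+ (k !)) {{k !≢0}} (begin
  binom a (suc k) * + suc k * + (k !)  ≡⟨ *suc-*! (binom a (suc k)) k ⟩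
  binom a (suc k) * + (suc k !)        ≡⟨ binom-! a (suc k) ⟩
  falling a k * (a - + k)              ≡⟨ cong (_* (a - + k)) (binom-! a k) ⟨
  binom a k * + (k !) * (a - + k)      ≡⟨ lemma (binom a k) (+ (k !)) (a - + k) ⟩
  binom a k * (a - + k) * + (k !)      ∎)
  where
  lemma : ∀ x y z → x * y * z ≡ x * z * y
  lemma = solve-∀

binom-sucˡ : ∀ a k → binom (+ 1 + a) (suc k) * + suc k ≡ (+ 1 + a) * binom a k
binom-sucˡ a k = *-cancelʳ-≡ _ _ (+ (k !)) {{k !≢0}} (begin
  binom (+ 1 + a) (suc k) * + suc k * + (k !)  ≡⟨ *suc-*! (binom (+ 1 + a) (suc k)) k ⟩
  binom (+ 1 + a) (suc k) * + (suc k !)        ≡⟨ binom-! (+ 1 + a) (suc k) ⟩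
  falling (+ 1 + a) (suc k)                    ≡⟨ falling-sucˡ a k ⟩
  (+ 1 + a) * falling a k                      ≡⟨ cong ((+ 1 + a) *_) (binom-! a k) ⟨
  (+ 1 + a) * (binom a k * + (k !))            ≡⟨ *-assoc (+ 1 + a) (binom a k) (+ (k !)) ⟨
  (+ 1 + a) * binom a k * + (k !)              ∎)

-- Finite sums, convolutions and the product rule.

sumBelow-linear : ∀ {f g h : ℕ → ℤ} c → (∀ k → h k ≡ f k + c * g k) →
  ∀ n → sumBelow n h ≡ sumBelow n f + c * sumBelow n g
sumBelow-linear c eq zero = sym (trans (+-identityˡ _) (*-zeroʳ c))
sumBelow-linear {f} {g} c eq (suc n) =
  trans (cong₂ _+_ (sumBelow-linear c eq n) (eq n))
        (lemma (sumBelow n f) c (sumBelow n g) (f n) (g n))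
  where
  lemma : ∀ s c t a b → s + c * t + (a + c * b) ≡ s + a + c * (t + b)
  lemma = solve-∀

sumBelow-cong : ∀ {f g : ℕ → ℤ} → (∀ k → f k ≡ g k) → ∀ n → sumBelow n f ≡ sumBelow n g
sumBelow-cong eq zero    = refl
sumBelow-cong eq (suc n) = cong₂ _+_ (sumBelow-cong eq n) (eq n)

sumBelow-sucˡ : ∀ f n → sumBelow (suc n) f ≡ f 0 + sumBelow n (f ∘ suc)
sumBelow-sucˡ f zero    = +-comm (+ 0) (f 0)
sumBelow-sucˡ f (suc n) =
  trans (cong (_+ f (suc n)) (sumBelow-sucˡ f n)) (lemma (f 0) _ (f (suc n)))
  where
  lemma : ∀ a b c → a + b + c ≡ a + (b + c)
  lemma = solve-∀

-- Coefficients of the product of two power series; `derivative` below gives those of the formal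
-- derivative.
conv : (ℕ → ℤ) → (ℕ → ℤ) → ℕ → ℤ
conv p q n = sumBelow (suc n) (λ k → p k * q (n ∸ k))

derivative : (ℕ → ℤ) → ℕ → ℤ
derivative p k = + suc k * p (suc k)

conv-sucˡ : ∀ p q n → conv p q (suc n) ≡ p 0 * q (suc n) + conv (p ∘ suc) q n
conv-sucˡ p q n = sumBelow-sucˡ (λ k → p k * q (suc n ∸ k)) (suc n)

-- For a variable k the index `suc n ∸ k` does not reduce to a successor, so the last term is split
-- off by induction, peeling the first term and shifting `p`.
conv-sucʳ : ∀ p q n → conv p q (suc n) ≡ conv p (q ∘ suc) n + p (suc n) * q 0
conv-sucʳ p q zero    = refl
conv-sucʳ p q (suc n) = begin
  conv p q (suc (suc n))
    ≡⟨ conv-sucˡ p q (suc n) ⟩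
  p 0 * q (suc (suc n)) + conv (p ∘ suc) q (suc n)
    ≡⟨ cong (_+_ (p 0 * q (suc (suc n)))) (conv-sucʳ (p ∘ suc) q n) ⟩
  p 0 * q (suc (suc n)) + (conv (p ∘ suc) (q ∘ suc) n + p (suc (suc n)) * q 0)
    ≡⟨ lemma (p 0 * q (suc (suc n))) _ _ ⟩
  p 0 * q (suc (suc n)) + conv (p ∘ suc) (q ∘ suc) n + p (suc (suc n)) * q 0
    ≡⟨ cong (_+ p (suc (suc n)) * q 0) (conv-sucˡ p (q ∘ suc) n) ⟨
  conv p (q ∘ suc) (suc n) + p (suc (suc n)) * q 0
    ∎
  where
  lemma : ∀ a b c → a + (b + c) ≡ a + b + c
  lemma = solve-∀

conv-linearˡ : ∀ {u v w : ℕ → ℤ} q c → (∀ k → w k ≡ u k + c * v k) →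
  ∀ n → conv w q n ≡ conv u q n + c * conv v q n
conv-linearˡ {u} {v} q c eq n = sumBelow-linear c
  (λ k → trans (cong (_* q (n ∸ k)) (eq k)) (lemma (u k) c (v k) (q (n ∸ k)))) (suc n)
  where
  lemma : ∀ u c v q → (u + c * v) * q ≡ u * q + c * (v * q)
  lemma = solve-∀

conv-linearʳ : ∀ {u v w : ℕ → ℤ} p c → (∀ k → w k ≡ u k + c * v k) →
  ∀ n → conv p w n ≡ conv p u n + c * conv p v n
conv-linearʳ {u} {v} p c eq n = sumBelow-linear c
  (λ k → trans (cong (p k *_) (eq (n ∸ k))) (lemma (u (n ∸ k)) c (v (n ∸ k)) (p k))) (suc n)
  where
  lemma : ∀ u c v p → p * (u + c * v) ≡ p * u + c * (p * v)
  lemma = solve-∀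

-- The rule (P Q)' = P' Q + P Q' for coefficients. The first term of each convolution is split off
-- and the induction hypothesis is applied to `p ∘ suc`.
leibniz : ∀ p q n →
  + suc n * conv p q (suc n) ≡ conv (derivative p) q n + conv p (derivative q) n
leibniz p q zero = lemma (p 0) (p 1) (q 0) (q 1)
  where
  lemma : ∀ p₀ p₁ q₀ q₁ → + 1 * (+ 0 + p₀ * q₁ + p₁ * q₀) ≡
    + 0 + + 1 * p₁ * q₀ + (+ 0 + p₀ * (+ 1 * q₁))
  lemma = solve-∀
leibniz p q (suc n) = begin
  + suc (suc n) * conv p q (suc (suc n))
    ≡⟨ cong (+ suc (suc n) *_) (conv-sucˡ p q (suc n)) ⟩
  + suc (suc n) * (p 0 * q (suc (suc n)) + C)
    ≡⟨ expand (+ suc n) (p 0) (q (suc (suc n))) C ⟩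
  + suc n * C + C + p 0 * (+ suc (suc n) * q (suc (suc n)))
    ≡⟨ cong₂ (λ a b → a + b + p 0 * (+ suc (suc n) * q (suc (suc n))))
         (leibniz (p ∘ suc) q n) (conv-sucˡ (p ∘ suc) q n) ⟩
  U + V + (p 1 * q (suc n) + W) + p 0 * (+ suc (suc n) * q (suc (suc n)))
    ≡⟨ regroup U V W (p 1) (q (suc n)) (p 0 * (+ suc (suc n) * q (suc (suc n)))) ⟩
  + 1 * p 1 * q (suc n) + (U + + 1 * W) + (p 0 * (+ suc (suc n) * q (suc (suc n))) + V)
    -- Differentiation and shift do not commute: `derivative p ∘ suc` exceeds `derivative (p ∘ suc)`
    -- by `p ∘ suc ∘ suc`, which accounts for `W`.
    ≡⟨ cong (λ a → + 1 * p 1 * q (suc n) + a + (p 0 * (+ suc (suc n) * q (suc (suc n))) + V))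
         (conv-linearˡ {derivative (p ∘ suc)} {p ∘ suc ∘ suc} q (+ 1) (λ k → split (+ suc k) (p (suc (suc k)))) n) ⟨
  + 1 * p 1 * q (suc n) + conv (derivative p ∘ suc) q n
    + (p 0 * (+ suc (suc n) * q (suc (suc n))) + V)
    ≡⟨ cong₂ _+_ (conv-sucˡ (derivative p) q n) (conv-sucˡ p (derivative q) n) ⟨
  conv (derivative p) q (suc n) + conv p (derivative q) (suc n)
    ∎
  where
  C = conv (p ∘ suc) q (suc n)
  U = conv (derivative (p ∘ suc)) q n
  V = conv (p ∘ suc) (derivative q) n
  W = conv (p ∘ suc ∘ suc) q n
  expand : ∀ n a b c → (+ 1 + n) * (a * b + c) ≡ n * c + c + a * ((+ 1 + n) * b)
  expand = solve-∀
  regroup : ∀ u v w a b c → u + v + (a * b + w) + c ≡ + 1 * a * b + (u + + 1 * w) + (c + v)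
  regroup = solve-∀
  split : ∀ k a → (+ 1 + k) * a ≡ k * a + + 1 * a
  split = solve-∀

-- Recurrence for a product of two binomial series.

-- The hypotheses say (1 - z) P' = α P and (1 + z) Q' = β Q for the generating functions P, Q,
-- whence (1 - z²) (P Q)' = (α (1 + z) + β (1 - z)) P Q.
module ConvRecurrence
  (p q : ℕ → ℤ) (α β : ℤ)
  (p-suc : ∀ k → + suc k * p (suc k) ≡ (α + + k) * p k)
  (q-suc : ∀ k → + suc k * q (suc k) ≡ (β - + k) * q k)
  where

  private
    F A B : ℕ → ℤ
    F = conv p q
    A = conv (derivative p) q
    B = conv p (derivative q)

  A-zero : A 0 ≡ α * F 0
  A-zero = trans (cong (λ z → + 0 + z * q 0) (p-suc 0)) (lemma α (p 0) (q 0))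
    where
    lemma : ∀ α p q → + 0 + (α + + 0) * p * q ≡ α * (+ 0 + p * q)
    lemma = solve-∀

  B-zero : B 0 ≡ β * F 0
  B-zero = trans (cong (λ z → + 0 + p 0 * z) (q-suc 0)) (lemma β (p 0) (q 0))
    where
    lemma : ∀ β p q → + 0 + p * ((β - + 0) * q) ≡ β * (+ 0 + p * q)
    lemma = solve-∀

  -- The coefficient of z^(n+1) in (1 - z) P' Q = α P Q.
  A-suc : ∀ n → A (suc n) ≡ A n + α * F (suc n)
  A-suc n = begin
    A (suc n)
      ≡⟨ conv-sucˡ (derivative p) q n ⟩
    derivative p 0 * q (suc n) + conv (derivative p ∘ suc) q n
      ≡⟨ cong₂ (λ a b → a * q (suc n) + b) (p-suc 0) (conv-linearˡ {derivative p} {p ∘ suc} q α derivative-suc n) ⟩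
    (α + + 0) * p 0 * q (suc n) + (A n + α * conv (p ∘ suc) q n)
      ≡⟨ lemma α (p 0) (q (suc n)) (A n) (conv (p ∘ suc) q n) ⟩
    A n + α * (p 0 * q (suc n) + conv (p ∘ suc) q n)
      ≡⟨ cong (λ z → A n + α * z) (conv-sucˡ p q n) ⟨
    A n + α * F (suc n)
      ∎
    where
    distrib : ∀ α k p → (α + k) * p ≡ k * p + α * p
    distrib = solve-∀
    derivative-suc : ∀ k → derivative p (suc k) ≡ derivative p k + α * p (suc k)
    derivative-suc k = trans (p-suc (suc k)) (distrib α (+ suc k) (p (suc k)))
    lemma : ∀ α p q a c → (α + + 0) * p * q + (a + α * c) ≡ a + α * (p * q + c)
    lemma = solve-∀

  -- The coefficient of z^(n+1) in (1 + z) P Q' = β P Q.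
  B-suc : ∀ n → B (suc n) ≡ β * F (suc n) - B n
  B-suc n = begin
    B (suc n)
      ≡⟨ conv-sucʳ p (derivative q) n ⟩
    conv p (derivative q ∘ suc) n + p (suc n) * derivative q 0
      ≡⟨ cong₂ (λ a b → a + p (suc n) * b) (conv-linearʳ {λ k → β * q (suc k)} {derivative q} p (- + 1) derivative-suc n) (q-suc 0) ⟩
    conv p (λ k → β * q (suc k)) n + - + 1 * B n + p (suc n) * ((β - + 0) * q 0)
      -- The zero sequence serves as first summand, so that linearity extracts the scalar β.
      ≡⟨ cong (λ z → z + - + 1 * B n + p (suc n) * ((β - + 0) * q 0))
           (conv-linearʳ {λ _ → + 0} {q ∘ suc} {λ k → β * q (suc k)} p β (λ k → sym (+-identityˡ _)) n) ⟩
    conv p (λ _ → + 0) n + β * conv p (q ∘ suc) n + - + 1 * B n + p (suc n) * ((β - + 0) * q 0)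
      ≡⟨ cong (λ z → z + β * conv p (q ∘ suc) n + - + 1 * B n + p (suc n) * ((β - + 0) * q 0))
           (conv-zeroʳ (suc n)) ⟩
    + 0 + β * conv p (q ∘ suc) n + - + 1 * B n + p (suc n) * ((β - + 0) * q 0)
      ≡⟨ lemma β (p (suc n)) (q 0) (B n) (conv p (q ∘ suc) n) ⟩
    β * (conv p (q ∘ suc) n + p (suc n) * q 0) - B n
      ≡⟨ cong (λ z → β * z - B n) (conv-sucʳ p q n) ⟨
    β * F (suc n) - B n
      ∎
    where
    conv-zeroʳ : ∀ m → sumBelow m (λ k → p k * + 0) ≡ + 0
    conv-zeroʳ zero    = refl
    conv-zeroʳ (suc m) = cong₂ _+_ (conv-zeroʳ m) (*-zeroʳ (p m))
    distrib : ∀ β k q → (β - k) * q ≡ β * q + - + 1 * (k * q)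
    distrib = solve-∀
    derivative-suc : ∀ k → derivative q (suc k) ≡ β * q (suc k) + - + 1 * derivative q k
    derivative-suc k = trans (q-suc (suc k)) (distrib β (+ suc k) (q (suc k)))
    lemma : ∀ β p q b c → + 0 + β * c + - + 1 * b + p * ((β - + 0) * q) ≡ β * (c + p * q) - b
    lemma = solve-∀

  -- The opposite signs in `A-suc` and `B-suc` turn the difference at n + 1 into the sum A n + B n,
  -- which `leibniz` evaluates.
  A-B : ∀ n → A n - B n ≡ (+ n + α - β) * F n
  A-B zero = trans (cong₂ _-_ A-zero B-zero) (lemma α β (F 0))
    where
    lemma : ∀ α β f → α * f - β * f ≡ (+ 0 + α - β) * f
    lemma = solve-∀
  A-B (suc n) = begin
    A (suc n) - B (suc n)
      ≡⟨ cong₂ _-_ (A-suc n) (B-suc n) ⟩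
    A n + α * F (suc n) - (β * F (suc n) - B n)
      ≡⟨ regroup (A n) (B n) α β (F (suc n)) ⟩
    A n + B n + (α - β) * F (suc n)
      ≡⟨ cong (_+ (α - β) * F (suc n)) (leibniz p q n) ⟨
    + suc n * F (suc n) + (α - β) * F (suc n)
      ≡⟨ lemma (+ suc n) α β (F (suc n)) ⟩
    (+ suc n + α - β) * F (suc n)
      ∎
    where
    regroup : ∀ a b α β f → a + α * f - (β * f - b) ≡ a + b + (α - β) * f
    regroup = solve-∀
    lemma : ∀ n α β f → n * f + (α - β) * f ≡ (n + α - β) * f
    lemma = solve-∀

  conv-one : F 1 ≡ (α + β) * F 0
  conv-one = begin
    F 1                      ≡⟨ one (F 1) ⟩
    + 1 * F 1                ≡⟨ leibniz p q 0 ⟩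
    A 0 + B 0                ≡⟨ cong₂ _+_ A-zero B-zero ⟩
    α * F 0 + β * F 0        ≡⟨ lemma α β (F 0) ⟩
    (α + β) * F 0            ∎
    where
    one : ∀ f → f ≡ + 1 * f
    one = solve-∀
    lemma : ∀ α β f → α * f + β * f ≡ (α + β) * f
    lemma = solve-∀

  -- Conversely, the sum at n + 1 leads to the difference at n, evaluated by `A-B`.
  conv-suc-suc : ∀ n →
    + suc (suc n) * F (suc (suc n)) ≡ (α + β) * F (suc n) + (+ n + α - β) * F n
  conv-suc-suc n = begin
    + suc (suc n) * F (suc (suc n))
      ≡⟨ leibniz p q (suc n) ⟩
    A (suc n) + B (suc n)
      ≡⟨ cong₂ _+_ (A-suc n) (B-suc n) ⟩
    A n + α * F (suc n) + (β * F (suc n) - B n)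
      ≡⟨ lemma (A n) (B n) α β (F (suc n)) ⟩
    (α + β) * F (suc n) + (A n - B n)
      ≡⟨ cong (_+_ ((α + β) * F (suc n))) (A-B n) ⟩
    (α + β) * F (suc n) + (+ n + α - β) * F n
      ∎
    where
    lemma : ∀ a b α β f → a + α * f + (β * f - b) ≡ (α + β) * f + (a - b)
    lemma = solve-∀

-- Newton series and their recurrence.

-- newton f n = Σ_i f i * C(n, i)
newton : (ℕ → ℤ) → ℕ → ℤ
newton f zero    = f 0
newton f (suc n) = newton f n + newton (f ∘ suc) n

newton-linear : ∀ {f g h : ℕ → ℤ} c → (∀ k → h k ≡ f k + c * g k) →
  ∀ n → newton h n ≡ newton f n + c * newton g n
newton-linear c eq zero = eq 0
newton-linear {f} {g} c eq (suc n) =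
  trans (cong₂ _+_ (newton-linear c eq n) (newton-linear c (eq ∘ suc) n))
        (lemma (newton f n) c (newton g n) (newton (f ∘ suc) n) (newton (g ∘ suc) n))
  where
  lemma : ∀ s c t a b → s + c * t + (a + c * b) ≡ s + a + c * (t + b)
  lemma = solve-∀

weighted : (ℕ → ℤ) → ℕ → ℤ
weighted f i = + i * f i

-- (n + 1) C(n, i) = (i + 1) C(n + 1, i + 1)
newton-weighted : ∀ f n → newton (weighted f) (suc n) ≡ + suc n * newton (f ∘ suc) n
newton-weighted f zero = lemma (f 0) (f 1)
  where
  lemma : ∀ a b → + 0 * a + + 1 * b ≡ + 1 * b
  lemma = solve-∀
newton-weighted f (suc n) = begin
  newton (weighted f) (suc n) + newton (weighted f ∘ suc) (suc n)
    ≡⟨ cong₂ _+_ (newton-weighted f n)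
         (newton-linear (+ 1) (λ k → split (+ k) (f (suc k))) (suc n)) ⟩
  + suc n * S + (newton (weighted (f ∘ suc)) (suc n) + + 1 * (S + SS))
    ≡⟨ cong (λ z → + suc n * S + (z + + 1 * (S + SS))) (newton-weighted (f ∘ suc) n) ⟩
  + suc n * S + (+ suc n * SS + + 1 * (S + SS))
    ≡⟨ lemma (+ suc n) S SS ⟩
  + suc (suc n) * (S + SS)
    ∎
  where
  S  = newton (f ∘ suc) n
  SS = newton (f ∘ suc ∘ suc) n
  split : ∀ k a → (+ 1 + k) * a ≡ k * a + + 1 * a
  split = solve-∀
  lemma : ∀ n s t → n * s + (n * t + + 1 * (s + t)) ≡ (+ 1 + n) * (s + t)
  lemma = solve-∀

-- The hypothesis fixes the ratio of consecutive coefficients; it is the one satisfied by 2^i C(x +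
-- r, 2r + i) with ρ = 2r + 1 and h = x - r.
module NewtonRecurrence
  (f : ℕ → ℤ) (ρ h : ℤ)
  (f-suc : ∀ i → (ρ + + i) * f (suc i) ≡ + 2 * (h - + i) * f i)
  where

  newton-one : ρ * newton f 1 ≡ (+ 2 * h + ρ) * newton f 0
  newton-one = begin
    ρ * (f 0 + f 1)                            ≡⟨ expand ρ (f 0) (f 1) ⟩
    ρ * f 0 + (ρ + + 0) * f 1                  ≡⟨ cong (_+_ (ρ * f 0)) (f-suc 0) ⟩
    ρ * f 0 + + 2 * (h - + 0) * f 0            ≡⟨ lemma ρ h (f 0) ⟩
    (+ 2 * h + ρ) * f 0                        ∎
    where
    expand : ∀ ρ a b → ρ * (a + b) ≡ ρ * a + (ρ + + 0) * b
    expand = solve-∀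
    lemma : ∀ ρ h a → ρ * a + + 2 * (h - + 0) * a ≡ (+ 2 * h + ρ) * a
    lemma = solve-∀

  private
    -- The hypothesis `f-suc` summed against C(n, i), after splitting ρ + i as (i + 1) + (ρ - 1) and
    -- separating h from i.
    newton-f-suc : ∀ n →
      newton (weighted f ∘ suc) n + (ρ - + 1) * newton (f ∘ suc) n ≡
      + 2 * h * newton f n - + 2 * newton (weighted f) n
    newton-f-suc n = begin
      newton (weighted f ∘ suc) n + (ρ - + 1) * newton (f ∘ suc) n
        ≡⟨ newton-linear (ρ - + 1) (λ i → split (+ i) ρ (f (suc i))) n ⟨
      newton common n
        ≡⟨ newton-linear (- + 2)
             (λ i → trans (f-suc i) (split′ (+ i) h (f i))) n ⟩
      newton (λ i → + 2 * h * f i) n + - + 2 * newton (weighted f) n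
        ≡⟨ cong (_+ - + 2 * newton (weighted f) n)
             (newton-linear {f = f} (+ 2 * h - + 1) (λ i → split″ h (f i)) n) ⟩
      newton f n + (+ 2 * h - + 1) * newton f n + - + 2 * newton (weighted f) n
        ≡⟨ lemma h (newton f n) (newton (weighted f) n) ⟩
      + 2 * h * newton f n - + 2 * newton (weighted f) n
        ∎
      where
      common : ℕ → ℤ
      common i = (ρ + + i) * f (suc i)
      split : ∀ i ρ a → (ρ + i) * a ≡ (+ 1 + i) * a + (ρ - + 1) * a
      split = solve-∀
      split′ : ∀ i h a → + 2 * (h - i) * a ≡ + 2 * h * a + - + 2 * (i * a)
      split′ = solve-∀
      split″ : ∀ h a → + 2 * h * a ≡ a + (+ 2 * h - + 1) * a
      split″ = solve-∀
      lemma : ∀ h a b → a + (+ 2 * h - + 1) * a + - + 2 * b ≡ + 2 * h * a - + 2 * b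
      lemma = solve-∀

  -- The unknowns besides the values of the series are shifted and weighted sums. `newton-weighted`
  -- at n + 1 produces `u₁`, which `newton-f-suc` removes; `newton-weighted` at n then replaces the
  -- remaining `t₁` by a multiple of `s₀`.
  newton-suc-suc : ∀ n → (+ suc n + ρ) * newton f (suc (suc n)) ≡
    (+ 2 * h + ρ) * newton f (suc n) + + suc n * newton f n
  newton-suc-suc n = begin
    (+ suc n + ρ) * (e₁ + s₁)
      ≡⟨ expand (+ suc n) ρ e₁ s₁ ⟩
    (+ suc n + ρ) * e₁ + + suc (suc n) * s₁ + (ρ - + 1) * s₁
      ≡⟨ cong (λ z → (+ suc n + ρ) * e₁ + z + (ρ - + 1) * s₁) (newton-weighted f (suc n)) ⟨
    (+ suc n + ρ) * e₁ + (t₁ + u₁) + (ρ - + 1) * s₁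
      ≡⟨ regroup ((+ suc n + ρ) * e₁) t₁ u₁ ((ρ - + 1) * s₁) ⟩
    (+ suc n + ρ) * e₁ + t₁ + (u₁ + (ρ - + 1) * s₁)
      ≡⟨ cong (_+_ ((+ suc n + ρ) * e₁ + t₁)) (newton-f-suc (suc n)) ⟩
    (+ suc n + ρ) * e₁ + t₁ + (+ 2 * h * e₁ - + 2 * t₁)
      ≡⟨ collect (+ suc n) ρ h e₁ t₁ ⟩
    (+ suc n + ρ + + 2 * h) * e₁ - t₁
      ≡⟨ cong (λ z → (+ suc n + ρ + + 2 * h) * e₁ - z) (newton-weighted f n) ⟩
    (+ suc n + ρ + + 2 * h) * (e₀ + s₀) - + suc n * s₀
      ≡⟨ finish (+ suc n) ρ h e₀ s₀ ⟩
    (+ 2 * h + ρ) * (e₀ + s₀) + + suc n * e₀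
      ∎
    where
    e₀ = newton f n
    s₀ = newton (f ∘ suc) n
    e₁ = newton f (suc n)
    s₁ = newton (f ∘ suc) (suc n)
    t₁ = newton (weighted f) (suc n)
    u₁ = newton (weighted f ∘ suc) (suc n)
    expand : ∀ n ρ e s → (n + ρ) * (e + s) ≡ (n + ρ) * e + (+ 1 + n) * s + (ρ - + 1) * s
    expand = solve-∀
    regroup : ∀ a t u s → a + (t + u) + s ≡ a + t + (u + s)
    regroup = solve-∀
    collect : ∀ n ρ h e t →
      (n + ρ) * e + t + (+ 2 * h * e - + 2 * t) ≡ (n + ρ + + 2 * h) * e - t
    collect = solve-∀
    finish : ∀ n ρ h e s →
      (n + ρ + + 2 * h) * (e + s) - n * s ≡ (+ 2 * h + ρ) * (e + s) + n * e
    finish = solve-∀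

-- Congruences for Newton series and divisibility by 8.

∣-newton : ∀ {m f} → (∀ i → m ∣ₛ f i) → ∀ n → m ∣ₛ newton f n
∣-newton m∣f zero    = m∣f 0
∣-newton m∣f (suc n) = Signed.∣m∣n⇒∣m+n (∣-newton m∣f n) (∣-newton (m∣f ∘ suc) n)

-- Modulo m only the term i = 0 survives, and its coefficient is C(n, 0) = 1.
∣-newton-head : ∀ {m f} → (∀ i → m ∣ₛ f (suc i)) → ∀ n → m ∣ₛ newton f n - f 0
∣-newton-head {m} {f} m∣f zero = divides (+ 0) (i≡j⇒i-j≡0 {f 0} refl)
∣-newton-head {m} {f} m∣f (suc n) =
  subst (m ∣ₛ_) (lemma (newton f n) (newton (f ∘ suc) n) (f 0))
    (Signed.∣m∣n⇒∣m+n (∣-newton-head m∣f n) (∣-newton m∣f n))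
  where
  lemma : ∀ a b c → a - c + b ≡ a + b - c
  lemma = solve-∀

2∣n²-n : ∀ n → + 2 ∣ₛ n * n - n
2∣n²-n n = subst (+ 2 ∣ₛ_) (lemma n) (!∣falling 2 n)
  where
  lemma : ∀ n → + 1 * (n - + 0) * (n - + 1) ≡ n * n - n
  lemma = solve-∀

module _ (c : ℕ → ℤ) (ρ h : ℤ) (c-one : ρ * c 1 ≡ h * c 0) where

  private
    f : ℕ → ℤ
    f i = (+ 2) ^ i * c i

  -- Let e be the value at m. The value at m + 1 is e + 2 w with w ≡ c 1 mod 2, and the form equals
  -- 4 (h e² + 2 h w e - ρ w²). Modulo 2, e² ≡ e ≡ c 0 and w² ≡ w ≡ c 1, so the bracket is congruent
  -- to h c 0 - ρ c 1, which is 0 by `c-one`.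
  8∣newton-form : ∀ m → + 8 ∣ₛ
    + 2 * (+ 2 * h + ρ) * newton f (suc m) * newton f m
      - ρ * (newton f (suc m) * newton f (suc m) + newton f m * newton f m)
  8∣newton-form m
    -- The powers of 2 in `f` give e ≡ c 0 mod 2, and for the increment `newton (f ∘ suc) m` ≡ 2 c 1
    -- mod 4.
    with ∣-newton-head {+ 2} {f} (λ i → divides ((+ 2) ^ i * c (suc i)) (twice ((+ 2) ^ i) (c (suc i)))) m
       | ∣-newton-head {+ 4} {f ∘ suc} (λ i → divides ((+ 2) ^ i * c (suc (suc i))) (four ((+ 2) ^ i) (c (suc (suc i))))) m
    where
    twice : ∀ t c → + 2 * t * c ≡ t * c * + 2
    twice = solve-∀
    four : ∀ t c → + 2 * (+ 2 * t) * c ≡ t * c * + 4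
    four = solve-∀
  ... | divides u e₀-eq | divides v s₀-eq
    with 2∣n²-n (newton f m) | 2∣n²-n (c 1 + + 2 * v)
  ... | divides a a-eq | divides b b-eq = divides (h * a + h * u + h * w * e₀ - ρ * b - ρ * v) (begin
    + 2 * (+ 2 * h + ρ) * (e₀ + s₀) * e₀ - ρ * ((e₀ + s₀) * (e₀ + s₀) + e₀ * e₀)
      ≡⟨ cong (λ s → + 2 * (+ 2 * h + ρ) * (e₀ + s) * e₀ - ρ * ((e₀ + s) * (e₀ + s) + e₀ * e₀)) s₀≡2w ⟩
    + 2 * (+ 2 * h + ρ) * (e₀ + + 2 * w) * e₀ - ρ * ((e₀ + + 2 * w) * (e₀ + + 2 * w) + e₀ * e₀)
      -- The bracket is arranged into differences known to be even, plus `h * f 0 - ρ * w`, which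
      -- `rest` shows to be even.
      ≡⟨ expand h ρ e₀ w ⟩
    + 4 * (h * (e₀ * e₀ - e₀) + h * (e₀ - f 0) + + 2 * (h * w * e₀) - ρ * (w * w - w)
      + (h * f 0 - ρ * w))
      ≡⟨ cong (+ 4 *_) (cong₂ _+_ (cong₂ _-_
           (cong₂ (λ y z → h * y + h * z + + 2 * (h * w * e₀)) a-eq e₀-eq)
           (cong (ρ *_) b-eq)) rest) ⟩
    + 4 * (h * (a * + 2) + h * (u * + 2) + + 2 * (h * w * e₀) - ρ * (b * + 2)
      + - (ρ * (+ 2 * v)))
      ≡⟨ collect h ρ a b u v (h * w * e₀) ⟩
    (h * a + h * u + h * w * e₀ - ρ * b - ρ * v) * + 8
      ∎)
    where
    e₀ = newton f m
    s₀ = newton (f ∘ suc) m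
    w  = c 1 + + 2 * v
    s₀≡2w : s₀ ≡ + 2 * w
    s₀≡2w = begin
      s₀                              ≡⟨ lemma₁ s₀ (c 1) ⟩
      s₀ - f 1 + + 2 * c 1            ≡⟨ cong (_+ + 2 * c 1) s₀-eq ⟩
      v * + 4 + + 2 * c 1             ≡⟨ lemma₂ v (c 1) ⟩
      + 2 * w                         ∎
      where
      lemma₁ : ∀ s c → s ≡ s - + 2 * c + + 2 * c
      lemma₁ = solve-∀
      lemma₂ : ∀ v c → v * + 4 + + 2 * c ≡ + 2 * (c + + 2 * v)
      lemma₂ = solve-∀
    rest : h * f 0 - ρ * w ≡ - (ρ * (+ 2 * v))
    rest = begin
      h * (+ 1 * c 0) - ρ * w           ≡⟨ lemma₁ h (c 0) (ρ * w) ⟩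
      h * c 0 - ρ * w                   ≡⟨ cong (_- ρ * w) c-one ⟨
      ρ * c 1 - ρ * w                   ≡⟨ lemma₂ ρ (c 1) v ⟩
      - (ρ * (+ 2 * v))                 ∎
      where
      lemma₁ : ∀ h c z → h * (+ 1 * c) - z ≡ h * c - z
      lemma₁ = solve-∀
      lemma₂ : ∀ ρ c v → ρ * c - ρ * (c + + 2 * v) ≡ - (ρ * (+ 2 * v))
      lemma₂ = solve-∀
    expand : ∀ h ρ e w →
      + 2 * (+ 2 * h + ρ) * (e + + 2 * w) * e - ρ * ((e + + 2 * w) * (e + + 2 * w) + e * e) ≡
      + 4 * (h * (e * e - e) + h * (e - f 0) + + 2 * (h * w * e) - ρ * (w * w - w)
        + (h * f 0 - ρ * w))
    expand h ρ e w = lemma h ρ e w (f 0)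
      where
      lemma : ∀ h ρ e w z →
        + 2 * (+ 2 * h + ρ) * (e + + 2 * w) * e - ρ * ((e + + 2 * w) * (e + + 2 * w) + e * e) ≡
        + 4 * (h * (e * e - e) + h * (e - z) + + 2 * (h * w * e) - ρ * (w * w - w)
          + (h * z - ρ * w))
      lemma = solve-∀
    collect : ∀ h ρ a b u v z →
      + 4 * (h * (a * + 2) + h * (u * + 2) + + 2 * z - ρ * (b * + 2) + - (ρ * (+ 2 * v))) ≡
      (h * a + h * u + z - ρ * b - ρ * v) * + 8
    collect = solve-∀

-- The symmetric product as falling factorials.

-- The factors 1 + b + j ascend, so their product is a falling factorial whose top b + k moves with
-- k; `falling-sucˡ` puts the new factor in front.
prodBelow-falling : ∀ (g : ℕ → ℤ) a b → (∀ j → g j ≡ (+ 1 + (b + + j)) * (a - + j)) →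
  ∀ k → prodBelow k g ≡ falling (b + + k) k * falling a k
prodBelow-falling g a b eq zero    = refl
prodBelow-falling g a b eq (suc k) = begin
  prodBelow k g * g k
    ≡⟨ cong₂ _*_ (prodBelow-falling g a b eq k) (eq k) ⟩
  falling (b + + k) k * falling a k * ((+ 1 + (b + + k)) * (a - + k))
    ≡⟨ regroup (falling (b + + k) k) (falling a k) (+ 1 + (b + + k)) (a - + k) ⟩
  (+ 1 + (b + + k)) * falling (b + + k) k * (falling a k * (a - + k))
    ≡⟨ cong (_* falling a (suc k)) (falling-sucˡ (b + + k) k) ⟨
  falling (+ 1 + (b + + k)) (suc k) * falling a (suc k)
    ≡⟨ cong (λ z → falling z (suc k) * falling a (suc k)) (shift b (+ k)) ⟩
  falling (b + + suc k) (suc k) * falling a (suc k)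
    ∎
  where
  regroup : ∀ u v w z → u * v * (w * z) ≡ w * u * (v * z)
  regroup = solve-∀
  shift : ∀ b k → + 1 + (b + k) ≡ b + (+ 1 + k)
  shift = solve-∀

-- One family of factors runs from x - r up to x + r, the other from x + r + 1 down to x - r + 1.
-- Both contain Π; what remains is x - r from the first and x + r + 1 from the second.
prodSym-falling : ∀ r x → prodSym r x ≡
  (x - + r) * (+ 1 + (x + + r)) * (falling (x + + r) (2 ℕ.* r) * falling (x + + r) (2 ℕ.* r))
prodSym-falling r x = begin
  prodSym r x
    ≡⟨ prodBelow-falling _ (+ 1 + (x + + r)) (x - + r - + 1)
         (λ j → factor x (+ r) (+ j)) (suc (2 ℕ.* r)) ⟩
  falling (x - + r - + 1 + + suc (2 ℕ.* r)) (suc (2 ℕ.* r)) * falling (+ 1 + (x + + r)) (suc (2 ℕ.* r))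
    ≡⟨ cong₂ _*_ (cong (λ z → falling z (suc (2 ℕ.* r))) (top x (+ r)))
         (falling-sucˡ (x + + r) (2 ℕ.* r)) ⟩
  Π * (x + + r - + (2 ℕ.* r)) * ((+ 1 + (x + + r)) * Π)
    ≡⟨ regroup Π x (+ r) ⟩
  (x - + r) * (+ 1 + (x + + r)) * (Π * Π)
    ∎
  where
  Π = falling (x + + r) (2 ℕ.* r)
  factor : ∀ x r j → (x + (j - r)) * (x + + 1 - (j - r)) ≡
    (+ 1 + (x - r - + 1 + j)) * (+ 1 + (x + r) - j)
  factor = solve-∀
  -- Here and in later ring identities `r + (r + + 0)` is what `+ (2 ℕ.* r)` unfolds to.
  top : ∀ x r → x - r - + 1 + (+ 1 + (r + (r + + 0))) ≡ x + r
  top = solve-∀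
  regroup : ∀ p x r → p * (x + r - (r + (r + + 0))) * ((+ 1 + (x + r)) * p) ≡
    (x - r) * (+ 1 + (x + r)) * (p * p)
  regroup = solve-∀

-- Rising factorials and the modulus.

ascending : ℕ → ℕ → ℕ
ascending n zero    = 1
ascending n (suc k) = ascending n k ℕ.* (n ℕ.+ k)

ascending-sucˡ : ∀ n k → ascending n (suc k) ≡ n ℕ.* ascending (suc n) k
ascending-sucˡ n zero = begin
  1 ℕ.* (n ℕ.+ 0)  ≡⟨ ℕ.*-identityˡ (n ℕ.+ 0) ⟩
  n ℕ.+ 0          ≡⟨ ℕ.+-identityʳ n ⟩
  n                ≡⟨ ℕ.*-identityʳ n ⟨
  n ℕ.* 1          ∎
ascending-sucˡ n (suc k) = begin
  ascending n (suc k) ℕ.* (n ℕ.+ suc k)            ≡⟨ cong₂ ℕ._*_ (ascending-sucˡ n k) (ℕ.+-suc n k) ⟩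
  n ℕ.* ascending (suc n) k ℕ.* (suc n ℕ.+ k)      ≡⟨ ℕ.*-assoc n (ascending (suc n) k) (suc n ℕ.+ k) ⟩
  n ℕ.* ascending (suc n) (suc k)                  ∎

+-ascending-sucˡ : ∀ n k → + ascending n (suc k) ≡ + n * + ascending (suc n) k
+-ascending-sucˡ n k = trans (cong +_ (ascending-sucˡ n k)) (pos-* n (ascending (suc n) k))

+-ascending-sucʳ : ∀ n k → + ascending n (suc k) ≡ + ascending n k * (+ n + + k)
+-ascending-sucʳ n k = pos-* (ascending n k) (n ℕ.+ k)

ascending-1 : ∀ k → ascending 1 k ≡ k !
ascending-1 zero    = refl
ascending-1 (suc k) =
  trans (cong (ℕ._* suc k) (ascending-1 k)) (ℕ.*-comm (k !) (suc k))

-- The variable `x` stands for the partial product of squares computed by the local function of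
-- `modulusProd`.
ascending-square-suc : ∀ n i {x} → x ≡ ascending n i ℕ.* ascending n i →
  x ℕ.* ((n ℕ.+ i) ℕ.* (n ℕ.+ i)) ≡ ascending n (suc i) ℕ.* ascending n (suc i)
ascending-square-suc n i eq = trans (cong (ℕ._* ((n ℕ.+ i) ℕ.* (n ℕ.+ i))) eq)
  (ℕ.[m*n]*[o*p]≡[m*o]*[n*p] (ascending n i) (ascending n i) (n ℕ.+ i) (n ℕ.+ i))

-- The local function go of modulusProd cannot be named here: the underscore is inferred from
-- the with-abstracted goal and stands for its value at suc i.
mutual
  modulusProd-square : ∀ n r →
    modulusProd n r ≡ ascending n (suc (2 ℕ.* r)) ℕ.* ascending n (suc (2 ℕ.* r))
  modulusProd-square n r with 2 ℕ.* r
  ... | i = go-square n r i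

  go-square : ∀ n r i → _ ≡ ascending n (suc i) ℕ.* ascending n (suc i)
  go-square n r zero    = ascending-square-suc n 0 refl
  go-square n r (suc i) = ascending-square-suc n (suc i) (go-square n r i)

-- Telescoping of the weighted sum of squares.

module Telescoping
  (D : ℕ → ℤ) (X ρ : ℤ)
  (D-one : D 1 ≡ X * D 0)
  (D-suc-suc : ∀ n → + suc (suc n) * D (suc (suc n)) ≡ X * D (suc n) + (+ n + ρ) * D n)
  where

  private
    weightedSquare : ℕ → ℤ
    weightedSquare k = (+ 2 * + k + ρ) * (D k * D k)

    form : ℤ → ℤ → ℤ
    form a b = ρ * (a * a + b * b) - + 2 * X * a * b

  -- With d = D (n + 1) and b = (n + ρ) D n, the recurrence sends the pair ((n + 1) d, b) to (X d +
  -- b, (n + 1 + ρ) d). The form then grows by exactly (ρ² - X²)(2 (n + 1) + ρ) d², a polynomial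
  -- identity with b as a free variable.
  sum-weightedSquare : ∀ n → (ρ * ρ - X * X) * sumBelow (suc n) weightedSquare ≡
    form (+ suc n * D (suc n)) ((+ n + ρ) * D n)
  sum-weightedSquare zero = begin
    (ρ * ρ - X * X) * (+ 0 + (+ 0 + ρ) * (D 0 * D 0))
      ≡⟨ lemma ρ X (D 0) ⟩
    ρ * (+ 1 * (X * D 0) * (+ 1 * (X * D 0)) + (+ 0 + ρ) * D 0 * ((+ 0 + ρ) * D 0))
      - + 2 * X * (+ 1 * (X * D 0)) * ((+ 0 + ρ) * D 0)
      ≡⟨ cong (λ z → form (+ 1 * z) ((+ 0 + ρ) * D 0)) D-one ⟨
    form (+ 1 * D 1) ((+ 0 + ρ) * D 0)
      ∎
    where
    lemma : ∀ ρ X d → (ρ * ρ - X * X) * (+ 0 + (+ 0 + ρ) * (d * d)) ≡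
      ρ * (+ 1 * (X * d) * (+ 1 * (X * d)) + (+ 0 + ρ) * d * ((+ 0 + ρ) * d))
        - + 2 * X * (+ 1 * (X * d)) * ((+ 0 + ρ) * d)
    lemma = solve-∀
  sum-weightedSquare (suc n) = begin
    (ρ * ρ - X * X) * (sumBelow (suc n) weightedSquare + weightedSquare (suc n))
      ≡⟨ distrib (ρ * ρ - X * X) (sumBelow (suc n) weightedSquare) (weightedSquare (suc n)) ⟩
    (ρ * ρ - X * X) * sumBelow (suc n) weightedSquare + (ρ * ρ - X * X) * weightedSquare (suc n)
      ≡⟨ cong (_+ (ρ * ρ - X * X) * weightedSquare (suc n)) (sum-weightedSquare n) ⟩
    form (+ suc n * D (suc n)) ((+ n + ρ) * D n) + (ρ * ρ - X * X) * weightedSquare (suc n)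
      ≡⟨ lemma ρ X (+ n) (D (suc n)) ((+ n + ρ) * D n) ⟩
    form (X * D (suc n) + (+ n + ρ) * D n) ((+ suc n + ρ) * D (suc n))
      ≡⟨ cong (λ z → form z ((+ suc n + ρ) * D (suc n))) (D-suc-suc n) ⟨
    form (+ suc (suc n) * D (suc (suc n))) ((+ suc n + ρ) * D (suc n))
      ∎
    where
    distrib : ∀ c a b → c * (a + b) ≡ c * a + c * b
    distrib = solve-∀
    lemma : ∀ ρ X n d b →
      ρ * ((+ 1 + n) * d * ((+ 1 + n) * d) + b * b) - + 2 * X * ((+ 1 + n) * d) * b
        + (ρ * ρ - X * X) * ((+ 2 * (+ 1 + n) + ρ) * (d * d)) ≡
      ρ * ((X * d + b) * (X * d + b) + (+ 1 + n + ρ) * d * ((+ 1 + n + ρ) * d))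
        - + 2 * X * (X * d + b) * ((+ 1 + n + ρ) * d)
    lemma = solve-∀

-- Comparison of two solutions of the recurrence.

-- D and (n + 1) ⋯ (n + K) e n satisfy the same second-order recurrence.
module Proportional
  (D e : ℕ → ℤ) (X Π : ℤ) (K : ℕ)
  (D-one : D 1 ≡ X * D 0)
  (D-suc-suc : ∀ n →
    + suc (suc n) * D (suc (suc n)) ≡ X * D (suc n) + (+ n + + suc K) * D n)
  (e-one : + suc K * e 1 ≡ X * e 0)
  (e-suc-suc : ∀ n →
    (+ suc n + + suc K) * e (suc (suc n)) ≡ X * e (suc n) + + suc n * e n)
  (initial : Π * D 0 ≡ + ascending 1 K * e 0)
  where

  proportional : ∀ n → Π * D n ≡ + ascending (suc n) K * e n
  proportional zero       = initial
  proportional (suc zero) = begin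
    Π * D 1                                 ≡⟨ cong (Π *_) D-one ⟩
    Π * (X * D 0)                           ≡⟨ swap Π X (D 0) ⟩
    X * (Π * D 0)                           ≡⟨ cong (X *_) initial ⟩
    X * (+ ascending 1 K * e 0)             ≡⟨ swap X (+ ascending 1 K) (e 0) ⟩
    + ascending 1 K * (X * e 0)             ≡⟨ cong (+ ascending 1 K *_) e-one ⟨
    + ascending 1 K * (+ suc K * e 1)       ≡⟨ *-assoc (+ ascending 1 K) (+ suc K) (e 1) ⟨
    + ascending 1 K * + suc K * e 1         ≡⟨ cong (_* e 1) (+-ascending-sucʳ 1 K) ⟨
    + ascending 1 (suc K) * e 1             ≡⟨ cong (_* e 1) (+-ascending-sucˡ 1 K) ⟩
    + 1 * + ascending 2 K * e 1             ≡⟨ one (+ ascending 2 K) (e 1) ⟩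
    + ascending 2 K * e 1                   ∎
    where
    swap : ∀ a b c → a * (b * c) ≡ b * (a * c)
    swap = solve-∀
    one : ∀ a b → + 1 * a * b ≡ a * b
    one = solve-∀
  -- The factor n + 2 makes `D-suc-suc` applicable and is cancelled at the end. In between, `shift`
  -- trades one rising factorial for the next, so that `a₂` factors out and `e-suc-suc` applies.
  proportional (suc (suc n)) = *-cancelˡ-≡ (+ suc (suc n)) _ _ (begin
    + suc (suc n) * (Π * D (suc (suc n)))
      ≡⟨ swap (+ suc (suc n)) Π (D (suc (suc n))) ⟩
    Π * (+ suc (suc n) * D (suc (suc n)))
      ≡⟨ cong (Π *_) (D-suc-suc n) ⟩
    Π * (X * D (suc n) + (+ n + + suc K) * D n)
      ≡⟨ distrib Π X (D (suc n)) (+ n + + suc K) (D n) ⟩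
    X * (Π * D (suc n)) + (+ n + + suc K) * (Π * D n)
      ≡⟨ cong₂ (λ y z → X * y + (+ n + + suc K) * z) (proportional (suc n)) (proportional n) ⟩
    X * (a₂ * e (suc n)) + (+ n + + suc K) * (a₁ * e n)
      ≡⟨ regroup X a₂ (e (suc n)) (+ n) (+ K) a₁ (e n) ⟩
    X * (a₂ * e (suc n)) + a₁ * (+ suc n + + K) * e n
      ≡⟨ cong (λ z → X * (a₂ * e (suc n)) + z * e n) (shift (suc n)) ⟩
    X * (a₂ * e (suc n)) + + suc n * a₂ * e n
      ≡⟨ factor X a₂ (e (suc n)) (+ suc n) (e n) ⟩
    a₂ * (X * e (suc n) + + suc n * e n)
      ≡⟨ cong (a₂ *_) (e-suc-suc n) ⟨
    a₂ * ((+ suc n + + suc K) * e (suc (suc n)))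
      ≡⟨ regroup′ a₂ (+ suc n) (+ K) (e (suc (suc n))) ⟩
    a₂ * (+ suc (suc n) + + K) * e (suc (suc n))
      ≡⟨ cong (_* e (suc (suc n))) (shift (suc (suc n))) ⟩
    + suc (suc n) * a₃ * e (suc (suc n))
      ≡⟨ *-assoc (+ suc (suc n)) a₃ (e (suc (suc n))) ⟩
    + suc (suc n) * (a₃ * e (suc (suc n)))
      ∎)
    where
    a₁ = + ascending (suc n) K
    a₂ = + ascending (suc (suc n)) K
    a₃ = + ascending (suc (suc (suc n))) K
    shift : ∀ m → + ascending m K * (+ m + + K) ≡ + m * + ascending (suc m) K
    shift m = trans (sym (+-ascending-sucʳ m K)) (+-ascending-sucˡ m K)
    swap : ∀ a b c → a * (b * c) ≡ b * (a * c)
    swap = solve-∀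
    distrib : ∀ p x a y b → p * (x * a + y * b) ≡ x * (p * a) + y * (p * b)
    distrib = solve-∀
    regroup : ∀ x a b n k c d → x * (a * b) + (n + (+ 1 + k)) * (c * d) ≡
      x * (a * b) + c * (+ 1 + n + k) * d
    regroup = solve-∀
    factor : ∀ x a b n d → x * (a * b) + n * a * d ≡ a * (x * b + n * d)
    factor = solve-∀
    regroup′ : ∀ a n k e → a * ((n + (+ 1 + k)) * e) ≡ a * (+ 1 + n + k) * e
    regroup′ = solve-∀

-- Divisibility of the sum by the squared rising factorial.

module SquareDivisibility
  (D c : ℕ → ℤ) (h Π : ℤ) (K : ℕ)
  (D-one : D 1 ≡ (+ 2 * h + + suc K) * D 0)
  (D-suc-suc : ∀ n → + suc (suc n) * D (suc (suc n)) ≡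
    (+ 2 * h + + suc K) * D (suc n) + (+ n + + suc K) * D n)
  (c-suc : ∀ i → (+ suc K + + i) * c (suc i) ≡ (h - + i) * c i)
  (Π-initial : Π * D 0 ≡ + ascending 1 K * c 0)
  where

  private
    ρ X : ℤ
    ρ = + suc K
    X = + 2 * h + ρ

    f : ℕ → ℤ
    f i = (+ 2) ^ i * c i

    f-suc : ∀ i → (ρ + + i) * f (suc i) ≡ + 2 * (h - + i) * f i
    f-suc i = begin
      (ρ + + i) * (+ 2 * (+ 2) ^ i * c (suc i))   ≡⟨ lemma₁ (ρ + + i) ((+ 2) ^ i) (c (suc i)) ⟩
      + 2 * (+ 2) ^ i * ((ρ + + i) * c (suc i))   ≡⟨ cong (+ 2 * (+ 2) ^ i *_) (c-suc i) ⟩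
      + 2 * (+ 2) ^ i * ((h - + i) * c i)         ≡⟨ lemma₂ (h - + i) ((+ 2) ^ i) (c i) ⟩
      + 2 * (h - + i) * f i                       ∎
      where
      lemma₁ : ∀ a t c → a * (+ 2 * t * c) ≡ + 2 * t * (a * c)
      lemma₁ = solve-∀
      lemma₂ : ∀ a t c → + 2 * t * (a * c) ≡ + 2 * a * (t * c)
      lemma₂ = solve-∀

    c-one : ρ * c 1 ≡ h * c 0
    c-one = begin
      ρ * c 1             ≡⟨ lemma₁ ρ (c 1) ⟩
      (ρ + + 0) * c 1     ≡⟨ c-suc 0 ⟩
      (h - + 0) * c 0     ≡⟨ lemma₂ h (c 0) ⟩
      h * c 0             ∎
      where
      lemma₁ : ∀ a c → a * c ≡ (a + + 0) * c
      lemma₁ = solve-∀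
      lemma₂ : ∀ a c → (a - + 0) * c ≡ a * c
      lemma₂ = solve-∀

    open NewtonRecurrence f ρ h f-suc

    e : ℕ → ℤ
    e = newton f

    initial : Π * D 0 ≡ + ascending 1 K * e 0
    initial = trans Π-initial (lemma (+ ascending 1 K) (c 0))
      where
      lemma : ∀ a c → a * c ≡ a * (+ 1 * c)
      lemma = solve-∀

    open Proportional D e X Π K D-one D-suc-suc newton-one newton-suc-suc initial
    open Telescoping D X ρ D-one D-suc-suc

  -- Multiplication by Π² turns the two arguments of the telescoped form into `M * e (suc m)` and
  -- `M * e m`. Thus M² comes out, and the form left in `e` is divisible by 8.
  8M²∣ : ∀ m → + 8 * (+ ascending (suc m) (suc K) * + ascending (suc m) (suc K)) ∣ₛ
    Π * Π * ((X * X - ρ * ρ) * sumBelow (suc m) (λ k → (+ 2 * + k + ρ) * (D k * D k)))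
  8M²∣ m = divides t (begin
    Π * Π * ((X * X - ρ * ρ) * S)
      ≡⟨ negate Π X ρ S ⟩
    - (Π * Π * ((ρ * ρ - X * X) * S))
      ≡⟨ cong (λ z → - (Π * Π * z)) (sum-weightedSquare m) ⟩
    - (Π * Π * (ρ * (a * a + b * b) - + 2 * X * a * b))
      ≡⟨ distrib Π ρ X a b ⟩
    + 2 * X * (Π * a) * (Π * b) - ρ * (Π * a * (Π * a) + Π * b * (Π * b))
      ≡⟨ cong₂ (λ y z → + 2 * X * y * z - ρ * (y * y + z * z)) Πa Πb ⟩
    + 2 * X * (M * e (suc m)) * (M * e m)
      - ρ * (M * e (suc m) * (M * e (suc m)) + M * e m * (M * e m))
      ≡⟨ factor M ρ X (e (suc m)) (e m) ⟩
    M * M * (+ 2 * X * e (suc m) * e m - ρ * (e (suc m) * e (suc m) + e m * e m))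
      ≡⟨ cong (M * M *_) (Signed._∣_.equality 8∣form) ⟩
    M * M * (t * + 8)
      ≡⟨ regroup M t ⟩
    t * (+ 8 * (M * M))
      ∎)
    where
    8∣form = 8∣newton-form c ρ h c-one m
    t = Signed._∣_.quotient 8∣form
    S = sumBelow (suc m) (λ k → (+ 2 * + k + ρ) * (D k * D k))
    M = + ascending (suc m) (suc K)
    a = + suc m * D (suc m)
    b = (+ m + ρ) * D m

    -- In `Πa` the factor m + 1 extends the rising factorial at its lower end; in `Πb` the factor m
    -- + ρ = m + 1 + K extends it at its upper end. Both reach the same `M`.
    Πa : Π * a ≡ M * e (suc m)
    Πa = begin
      Π * (+ suc m * D (suc m))                           ≡⟨ swap Π (+ suc m) (D (suc m)) ⟩
      + suc m * (Π * D (suc m))                           ≡⟨ cong (+ suc m *_) (proportional (suc m)) ⟩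
      + suc m * (+ ascending (suc (suc m)) K * e (suc m)) ≡⟨ *-assoc (+ suc m) (+ ascending (suc (suc m)) K) (e (suc m)) ⟨
      + suc m * + ascending (suc (suc m)) K * e (suc m)   ≡⟨ cong (_* e (suc m)) (+-ascending-sucˡ (suc m) K) ⟨
      M * e (suc m)                                       ∎
      where
      swap : ∀ a b c → a * (b * c) ≡ b * (a * c)
      swap = solve-∀

    Πb : Π * b ≡ M * e m
    Πb = begin
      Π * ((+ m + ρ) * D m)                               ≡⟨ swap Π (+ m + ρ) (D m) ⟩
      (+ m + ρ) * (Π * D m)                               ≡⟨ cong ((+ m + ρ) *_) (proportional m) ⟩
      (+ m + ρ) * (+ ascending (suc m) K * e m)           ≡⟨ shift (+ m) (+ K) (+ ascending (suc m) K) (e m) ⟩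
      + ascending (suc m) K * (+ suc m + + K) * e m       ≡⟨ cong (_* e m) (+-ascending-sucʳ (suc m) K) ⟨
      M * e m                                             ∎
      where
      swap : ∀ a b c → a * (b * c) ≡ b * (a * c)
      swap = solve-∀
      shift : ∀ m k a e → (m + (+ 1 + k)) * (a * e) ≡ a * (+ 1 + m + k) * e
      shift = solve-∀

    negate : ∀ p X ρ s → p * p * ((X * X - ρ * ρ) * s) ≡ - (p * p * ((ρ * ρ - X * X) * s))
    negate = solve-∀
    distrib : ∀ p ρ X a b → - (p * p * (ρ * (a * a + b * b) - + 2 * X * a * b)) ≡
      + 2 * X * (p * a) * (p * b) - ρ * (p * a * (p * a) + p * b * (p * b))
    distrib = solve-∀
    factor : ∀ m ρ X a b →
      + 2 * X * (m * a) * (m * b) - ρ * (m * a * (m * a) + m * b * (m * b)) ≡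
      m * m * (+ 2 * X * a * b - ρ * (a * a + b * b))
    factor = solve-∀
    regroup : ∀ m t → m * m * (t * + 8) ≡ t * (+ 8 * (m * m))
    regroup = solve-∀

-- The binomial sum `d` as an instance.

module BinomialSum (r : ℕ) (x : ℤ) where

  private
    K : ℕ
    K = 2 ℕ.* r

    ρ h X : ℤ
    ρ = + suc K
    h = x - + r
    X = + 2 * h + ρ

    D c : ℕ → ℤ
    D n = d (+ r) n x
    -- With `i` on the left, the lower index is K at zero and reduces to a successor at `suc i`, as
    -- `binom-sucʳ` requires.
    c i = binom (x + + r) (i ℕ.+ K)

    p q : ℕ → ℤ
    -- Coefficients of (1 - z)^(-x-r-1); `q` has those of (1 + z)^(x-r).
    p k = binom (x + + r + + k) k
    q = binom h

    p-suc : ∀ k → + suc k * p (suc k) ≡ (x + + r + + 1 + + k) * p k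
    p-suc k = begin
      + suc k * binom (x + + r + + suc k) (suc k)
        ≡⟨ cong (λ z → + suc k * binom z (suc k)) (shift (x + + r) (+ k)) ⟩
      + suc k * binom (+ 1 + (x + + r + + k)) (suc k)
        ≡⟨ *-comm (+ suc k) (binom (+ 1 + (x + + r + + k)) (suc k)) ⟩
      binom (+ 1 + (x + + r + + k)) (suc k) * + suc k
        ≡⟨ binom-sucˡ (x + + r + + k) k ⟩
      (+ 1 + (x + + r + + k)) * p k
        ≡⟨ cong (_* p k) (shift′ (x + + r) (+ k)) ⟩
      (x + + r + + 1 + + k) * p k
        ∎
      where
      shift : ∀ y k → y + (+ 1 + k) ≡ + 1 + (y + k)
      shift = solve-∀
      shift′ : ∀ y k → + 1 + (y + k) ≡ y + + 1 + k
      shift′ = solve-∀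

    q-suc : ∀ k → + suc k * q (suc k) ≡ (h - + k) * q k
    q-suc k = begin
      + suc k * q (suc k)    ≡⟨ *-comm (+ suc k) (q (suc k)) ⟩
      q (suc k) * + suc k    ≡⟨ binom-sucʳ h k ⟩
      q k * (h - + k)        ≡⟨ *-comm (q k) (h - + k) ⟩
      (h - + k) * q k        ∎

    -- `D` unfolds to `conv p q`. Here α = x + r + 1 and β = x - r, so α + β = 2x + 1 = X and α - β
    -- = 2r + 1 = ρ.
    open ConvRecurrence p q (x + + r + + 1) h p-suc q-suc

    X-eq : ∀ x r → x + r + + 1 + (x - r) ≡ + 2 * (x - r) + (+ 1 + (r + (r + + 0)))
    X-eq = solve-∀

    D-one : D 1 ≡ X * D 0
    D-one = trans conv-one (cong (_* D 0) (X-eq x (+ r)))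

    D-suc-suc : ∀ n → + suc (suc n) * D (suc (suc n)) ≡ X * D (suc n) + (+ n + ρ) * D n
    D-suc-suc n = trans (conv-suc-suc n)
      (cong₂ (λ y z → y * D (suc n) + z * D n) (X-eq x (+ r)) (ρ-eq (+ n) x (+ r)))
      where
      ρ-eq : ∀ n x r → n + (x + r + + 1) - (x - r) ≡ n + (+ 1 + (r + (r + + 0)))
      ρ-eq = solve-∀

    c-suc : ∀ i → (ρ + + i) * c (suc i) ≡ (h - + i) * c i
    c-suc i = begin
      (ρ + + i) * c (suc i)                 ≡⟨ lemma₁ (+ r) (+ i) (c (suc i)) ⟩
      c (suc i) * + suc (i ℕ.+ K)           ≡⟨ binom-sucʳ (x + + r) (i ℕ.+ K) ⟩
      c i * (x + + r - + (i ℕ.+ K))         ≡⟨ lemma₂ (+ r) (+ i) (c i) x ⟩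
      (h - + i) * c i                       ∎
      where
      lemma₁ : ∀ r i c → (+ 1 + (r + (r + + 0)) + i) * c ≡ c * (+ 1 + (i + (r + (r + + 0))))
      lemma₁ = solve-∀
      lemma₂ : ∀ r i c x → c * (x + r - (i + (r + (r + + 0)))) ≡ (x - r - i) * c
      lemma₂ = solve-∀

    Π-initial : falling (x + + r) K * D 0 ≡ + ascending 1 K * c 0
    Π-initial = begin
      -- `D 0` evaluates to 1.
      falling (x + + r) K * + 1     ≡⟨ cong (_* + 1) (binom-! (x + + r) K) ⟨
      c 0 * + (K !) * + 1           ≡⟨ lemma (c 0) (+ (K !)) ⟩
      + (K !) * c 0                 ≡⟨ cong (λ z → + z * c 0) (ascending-1 K) ⟨
      + ascending 1 K * c 0         ∎
      where
      lemma : ∀ c k → c * k * + 1 ≡ k * c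
      lemma = solve-∀

  open SquareDivisibility D c h (falling (x + + r) K) K D-one D-suc-suc c-suc Π-initial public

-- Passage to the stated modulus.

2modulusProd : ∀ n r → let M = + ascending n (suc (2 ℕ.* r)) in
  + (2 ℕ.* modulusProd n r) ≡ + 2 * (M * M)
2modulusProd n r = begin
  + (2 ℕ.* modulusProd n r)          ≡⟨ pos-* 2 (modulusProd n r) ⟩
  + 2 * + modulusProd n r            ≡⟨ cong (λ z → + 2 * + z) (modulusProd-square n r) ⟩
  + 2 * + (N ℕ.* N)                  ≡⟨ cong (+ 2 *_) (pos-* N N) ⟩
  + 2 * (+ N * + N)                  ∎
  where N = ascending n (suc (2 ℕ.* r))

-- X² - ρ² = 4 h (h + ρ) with h = x - r and h + ρ = x + r + 1, the two factors beside Π² in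
-- `prodSym-falling`.
4*prodSym : ∀ r x s →
  let Π = falling (x + + r) (2 ℕ.* r); ρ = + suc (2 ℕ.* r); X = + 2 * (x - + r) + ρ in
  Π * Π * ((X * X - ρ * ρ) * s) ≡ + 4 * (prodSym r x * s)
4*prodSym r x s = trans (lemma x (+ r) (falling (x + + r) (2 ℕ.* r)) s)
  (cong (λ z → + 4 * (z * s)) (sym (prodSym-falling r x)))
  where
  lemma : ∀ x r p s →
    p * p * (((+ 2 * (x - r) + (+ 1 + (r + (r + + 0)))) * (+ 2 * (x - r) + (+ 1 + (r + (r + + 0))))
      - (+ 1 + (r + (r + + 0))) * (+ 1 + (r + (r + + 0)))) * s) ≡
    + 4 * ((x - r) * (+ 1 + (x + r)) * (p * p) * s)
  lemma = solve-∀

-- A factor 4 is cancelled: 8 M² is 4 times the modulus, and the right side is 4 times the product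
-- with s.
2modulusProd∣ : ∀ n r x s →
  let Π = falling (x + + r) (2 ℕ.* r); ρ = + suc (2 ℕ.* r); X = + 2 * (x - + r) + ρ
      M = + ascending n (suc (2 ℕ.* r)) in
  + 8 * (M * M) ∣ₛ Π * Π * ((X * X - ρ * ρ) * s) →
  + (2 ℕ.* modulusProd n r) ∣ₛ prodSym r x * s
2modulusProd∣ n r x s 8M²∣ = subst (_∣ₛ prodSym r x * s) (sym (2modulusProd n r))
  (Signed.*-cancelˡ-∣ (+ 4)
    (subst₂ _∣ₛ_ (*-assoc (+ 4) (+ 2) (M * M)) (4*prodSym r x s) 8M²∣))
  where M = + ascending n (suc (2 ℕ.* r))

theorem2p5 : (n r : ℕ) → n ≥ 1 → (x : ℤ) →
    + (2 ℕ.* modulusProd n r) ∣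
    (+ (2 ℕ.* r ℕ.+ 1) * prodSym r x *
    sumBelow n (λ k → + (2 ℕ.* k ℕ.+ 2 ℕ.* r ℕ.+ 1) * (d (+ r) k x * d (+ r) k x)))
-- With n = m + 1 the sum has the length `suc m` for which `8M²∣` is stated; `weight` matches the
-- two forms of the coefficient 2k + 2r + 1.
theorem2p5 (suc m) r (s≤s _) x = ∣⇒∣ᵤ (subst (+ (2 ℕ.* modulusProd (suc m) r) ∣ₛ_)
  (trans (cong (λ z → + (2 ℕ.* r ℕ.+ 1) * (prodSym r x * z)) (sumBelow-cong weight (suc m)))
         (sym (*-assoc (+ (2 ℕ.* r ℕ.+ 1)) (prodSym r x) _)))
  (Signed.∣n⇒∣m*n (+ (2 ℕ.* r ℕ.+ 1)) (2modulusProd∣ (suc m) r x _ (BinomialSum.8M²∣ r x m))))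
  where
  lemma : ∀ k r → + 2 * k + (+ 1 + (r + (r + + 0))) ≡ k + (k + + 0) + (r + (r + + 0)) + + 1
  lemma = solve-∀
  weight : ∀ k → (+ 2 * + k + + suc (2 ℕ.* r)) * (d (+ r) k x * d (+ r) k x) ≡
    + (2 ℕ.* k ℕ.+ 2 ℕ.* r ℕ.+ 1) * (d (+ r) k x * d (+ r) k x)
  weight k = cong (_* (d (+ r) k x * d (+ r) k x)) (lemma (+ k) (+ r))
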